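{- Let $G$ be a connected graph of order $n\ge 3$. Then $\Gamma_{\rm cer}(G)=n-2$ if and only if $G$ is a simple diadem, a diadem, or one of the graphs $K_2+\overline{K}_{n-2}$ and $\overline{K}_2+\overline{K}_{n-2}$.
   Context: All graphs are finite and simple. $+$ denotes the join of graphs and $\overline{K}_m$ the edgeless graph on $m$ vertices. A graph is a corona if it is isomorphic to $H\circ K_1$ for some graph $H$ (one pendant vertex attached to each vertex of $H$); in a corona, a leaf is a vertex of degree one and a support is a neighbor of a leaf. A simple diadem is a graph obtained from a corona by adding one new vertex adjacent to exactly one support of the corona. A diadem is a graph obtained from a corona by adding one new vertex adjacent to exactly one leaf and that leaf's neighbor in the corona. A certified dominating set of $G$ is a set $D\subseteq V_G$ such that every vertex of $V_G-D$ has a neighbor in $D$ and every vertex in $D$ has either zero or at least two neighbors in $V_G-D$; $\Gamma_{\rm cer}(G)$ is the maximum cardinality of a minimal (with respect to inclusion) certified dominating set of $G$. -}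

module Defs where

open import Data.Nat using (ℕ; zero; suc; _+_; _≤_; _∸_)
open import Data.Fin using (Fin; zero; suc; splitAt; _↑ˡ_; _↑ʳ_; _≟_)
open import Data.Fin.Subset using (Subset; _∈_; _∉_; _⊂_; ∣_∣)
open import Data.Bool using (Bool; true; false; T; not; _∧_)
open import Data.Vec using (tabulate; lookup)
open import Data.Sum using (_⊎_; inj₁; inj₂)
open import Data.Product using (Σ; ∃; _×_; _,_)
open import Relation.Nullary using (¬_)
open import Relation.Nullary.Decidable using (⌊_⌋)
open import Relation.Binary.PropositionalEquality using (_≡_)
open import Function.Bundles using (_↔_; Inverse)

Graph : ℕ → Set
Graph n = Fin n → Fin n → Bool

Adj : ∀ {n} → Graph n → Fin n → Fin n → Set
Adj G u v = T (G u v)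

IsSimple : ∀ {n} → Graph n → Set
IsSimple G = (∀ x y → G x y ≡ G y x) × (∀ x → G x x ≡ false)

data Reach {n} (G : Graph n) : Fin n → Fin n → Set where
  here : ∀ {u} → Reach G u u
  step : ∀ {u w v} → Adj G u w → Reach G w v → Reach G u v

Connected : ∀ {n} → Graph n → Set
Connected G = ∀ u v → Reach G u v

Iso : ∀ {a b} → Graph a → Graph b → Set
Iso {a} {b} G H = Σ (Fin a ↔ Fin b) λ f →
  ∀ x y → G x y ≡ H (Inverse.to f x) (Inverse.to f y)

outNbrs : ∀ {n} → Graph n → Subset n → Fin n → Subset n
outNbrs G D v = tabulate λ u → G v u ∧ not (lookup D u)

IsDominating : ∀ {n} → Graph n → Subset n → Set
IsDominating G D = ∀ v → v ∉ D → ∃ λ u → u ∈ D × Adj G v u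

IsCertified : ∀ {n} → Graph n → Subset n → Set
IsCertified G D = ∀ v → v ∈ D →
  (∣ outNbrs G D v ∣ ≡ 0) ⊎ (2 ≤ ∣ outNbrs G D v ∣)

IsCertDom : ∀ {n} → Graph n → Subset n → Set
IsCertDom G D = IsDominating G D × IsCertified G D

IsMinimalCertDom : ∀ {n} → Graph n → Subset n → Set
IsMinimalCertDom G D = IsCertDom G D × (∀ D′ → D′ ⊂ D → ¬ IsCertDom G D′)

GammaCerIs : ∀ {n} → Graph n → ℕ → Set
GammaCerIs G k =
  (∃ λ D → IsMinimalCertDom G D × ∣ D ∣ ≡ k) ×
  (∀ D → IsMinimalCertDom G D → ∣ D ∣ ≤ k)

blocks : ∀ {a b} → (Fin a → Fin a → Bool) → (Fin a → Fin b → Bool)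
       → (Fin b → Fin b → Bool) → Graph (a + b)
blocks {a} A B C x y with splitAt a x | splitAt a y
... | inj₁ i | inj₁ j = A i j
... | inj₁ i | inj₂ j = B i j
... | inj₂ i | inj₁ j = B j i
... | inj₂ i | inj₂ j = C i j

join : ∀ {a b} → Graph a → Graph b → Graph (a + b)
join G H = blocks G (λ _ _ → true) H

complete : ∀ n → Graph n
complete n x y = not ⌊ x ≟ y ⌋

edgeless : ∀ n → Graph n
edgeless n _ _ = false

-- corona H ∘ K₁ : vertex i ↑ˡ m is a copy of vertex i of H (support),
-- vertex m ↑ʳ i is the pendant leaf attached to it
corona : ∀ {m} → Graph m → Graph (m + m)
corona H = blocks H (λ i j → ⌊ i ≟ j ⌋) (λ _ _ → false)

extend : ∀ {k} → Graph k → (Fin k → Bool) → Graph (suc k)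
extend G N zero    zero    = false
extend G N zero    (suc y) = N y
extend G N (suc x) zero    = N x
extend G N (suc x) (suc y) = G x y

IsSimpleDiadem : ∀ {n} → Graph n → Set
IsSimpleDiadem G = ∃ λ m → Σ (Graph m) λ H → IsSimple H × Σ (Fin m) λ s →
  Iso (extend (corona H) (λ x → ⌊ x ≟ (s ↑ˡ m) ⌋)) G

IsDiadem : ∀ {n} → Graph n → Set
IsDiadem G = ∃ λ m → Σ (Graph m) λ H → IsSimple H × Σ (Fin m) λ s →
  Iso (extend (corona H) (λ x → ⌊ x ≟ (s ↑ˡ m) ⌋ Data.Bool.∨ ⌊ x ≟ (m ↑ʳ s) ⌋)) G

{-# OPTIONS --safe #-}
module Submission where

-- Let D be a minimal certified dominating set of size n - 2, with complement {a , b}. Certification forces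
-- every vertex of D to see both or neither of a and b; call the former hubs. Fix a hub s, and let S
-- consist of s, of every support (neighbour of a degree-one vertex of D), and of a greedily chosen
-- independent set of further non-leaves. Together with those leaves whose support has no other
-- neighbour outside S, it is a certified dominating set D′ ⊆ D: a chosen non-hub has all its ≥ 2
-- neighbours outside D′, and a support loses its leaf exactly when it loses another neighbour.
-- By minimality D′ = D, so every support is a non-hub with a unique leaf, and a vertex of D that is
-- neither s, a leaf nor a support has no neighbour in D. With two hubs, varying s shows that the
-- hubs are independent and connectedness leaves no other vertex, so G is a join; with one hub,
-- G - b is a corona in which a is the leaf of s.

open import Defs
open import Data.Nat using (ℕ; zero; suc; _+_; _≤_; _∸_; z≤n; s≤s)
open import Data.Nat.Properties using (≤-trans; ≤-reflexive; ≤-antisym; m∸[m∸n]≡n; ∸-monoʳ-≤)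
open import Data.Bool using (Bool; true; false; T; not; _∧_; _∨_)
open import Data.Bool.Properties using (T?; T-∧; T-∨; ∧-identityʳ; ∧-zeroʳ; T-≡; T-not-≡)
open import Data.Empty using (⊥-elim)
open import Data.Fin using (Fin; zero; suc; splitAt; _↑ˡ_; _↑ʳ_; _≟_)
open import Data.Fin.Patterns using (0F; 1F)
open import Data.Fin.Properties using (any?; all?; injective⇒≤; ↑ˡ-injective; ↑ʳ-injective; splitAt-↑ˡ; splitAt-↑ʳ; join-splitAt)
import Data.Fin.Properties as Fin
open import Data.Fin.Subset using (Subset; _∈_; _∉_; _⊆_; _⊂_; ∣_∣; _∪_; ∁; ⁅_⁆; inside; outside)
open import Data.Fin.Subset.Properties using (_∈?_; x∈⁅x⁆; x∈⁅y⁆⇒x≡y; x∈∁p⇒x∉p; x∉p⇒x∈∁p; x∉∁p⇒x∈p; x∈p⇒x∉∁p; ∣∁p∣≡n∸∣p∣; ∣p∣≤n; x∈p∪q⁻; x∈p∪q⁺)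
open import Data.List using (List; []; _∷_; allFin)
import Data.List.Membership.Propositional as List
open import Data.List.Membership.Propositional.Properties using (∈-allFin)
open import Data.List.Relation.Unary.Any using (here; there)
open import Data.Product using (Σ; ∃; ∃₂; _×_; _,_; proj₁; proj₂)
open import Data.Sum using (_⊎_; inj₁; inj₂; [_,_]′)
open import Data.Vec using ([]; _∷_; here; there; tabulate; lookup)
open import Data.Vec.Properties using (lookup∘tabulate; lookup⇒[]=; []=⇒lookup)
open import Function using (_∘_)
open import Function.Bundles using (_⇔_; mk⇔; _↔_; mk↔ₛ′; Equivalence; Injection; Inverse)
open import Function.Properties.Inverse using (↔⇒↣)
open import Function.Definitions using (Injective)
open import Relation.Binary.PropositionalEquality using (_≡_; _≢_; refl; sym; trans; cong; cong₂; subst)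
open import Relation.Nullary using (¬_; Dec; yes; no; ¬?; contradiction)
open import Relation.Nullary.Decidable using (⌊_⌋; toWitness; fromWitness; _×-dec_; _⊎-dec_; _→-dec_; decidable-stable)
open import Relation.Unary using (Decidable)

private variable
  n : ℕ

-- Boolean values and decision procedures.

T-ext : ∀ {x y} → (T x → T y) → (T y → T x) → x ≡ y
T-ext {false} {false} f g = refl
T-ext {false} {true}  f g = ⊥-elim (g _)
T-ext {true}  {false} f g = ⊥-elim (f _)
T-ext {true}  {true}  f g = refl

¬T⇒≡false : ∀ {x} → ¬ T x → x ≡ false
¬T⇒≡false ¬x = T-ext (⊥-elim ∘ ¬x) λ ()

⌊⌋-unique : ∀ {P : Set} {x} (P? : Dec P) → (T x → P) → (P → T x) → x ≡ ⌊ P? ⌋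
⌊⌋-unique P? f g = T-ext (fromWitness ∘ f) (g ∘ toWitness)

⌊⌋-cong : ∀ {P Q : Set} (P? : Dec P) (Q? : Dec Q) → (P → Q) → (Q → P) → ⌊ P? ⌋ ≡ ⌊ Q? ⌋
⌊⌋-cong P? Q? f g = ⌊⌋-unique Q? (f ∘ toWitness) (fromWitness ∘ g)

⌊⌋-∨ : ∀ {P Q R : Set} (P? : Dec P) (Q? : Dec Q) (R? : Dec R) →
  (P → R) → (Q → R) → (R → P ⊎ Q) → ⌊ P? ⌋ ∨ ⌊ Q? ⌋ ≡ ⌊ R? ⌋
⌊⌋-∨ P? Q? R? f g h = ⌊⌋-unique R?
  (λ t → [ f ∘ toWitness , g ∘ toWitness ]′ (Equivalence.to (T-∨ {⌊ P? ⌋}) t))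
  (λ r → Equivalence.from (T-∨ {⌊ P? ⌋}) (Data.Sum.map fromWitness fromWitness (h r)))

-- Finite subsets

abstract
  comprehension : {P : Fin n → Set} → Decidable P → Subset n
  comprehension P? = tabulate λ x → ⌊ P? x ⌋

  ∈-comprehension⁺ : {P : Fin n → Set} (P? : Decidable P) → ∀ {x} → P x → x ∈ comprehension P?
  ∈-comprehension⁺ P? {x} px = lookup⇒[]= x _
    (trans (lookup∘tabulate _ x) (Equivalence.to T-≡ (fromWitness px)))

  ∈-comprehension⁻ : {P : Fin n → Set} (P? : Decidable P) → ∀ {x} → x ∈ comprehension P? → P x
  ∈-comprehension⁻ P? {x} x∈ = toWitness
    (Equivalence.from T-≡ (trans (sym (lookup∘tabulate _ x)) ([]=⇒lookup x∈)))

enumerate : (S : Subset n) → Fin ∣ S ∣ → Fin n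
enumerate (inside  ∷ S) zero    = zero
enumerate (inside  ∷ S) (suc i) = suc (enumerate S i)
enumerate (outside ∷ S) i       = suc (enumerate S i)

enumerate-∈ : (S : Subset n) (i : Fin ∣ S ∣) → enumerate S i ∈ S
enumerate-∈ (inside  ∷ S) zero    = here
enumerate-∈ (inside  ∷ S) (suc i) = there (enumerate-∈ S i)
enumerate-∈ (outside ∷ S) i       = there (enumerate-∈ S i)

enumerate-injective : (S : Subset n) → Injective _≡_ _≡_ (enumerate S)
enumerate-injective (inside  ∷ S) {zero}  {zero}  eq = refl
enumerate-injective (inside  ∷ S) {suc i} {suc j} eq =
  cong suc (enumerate-injective S (Fin.suc-injective eq))
enumerate-injective (outside ∷ S) eq = enumerate-injective S (Fin.suc-injective eq)

enumerate-surjective : (S : Subset n) → ∀ {x} → x ∈ S → ∃ λ i → enumerate S i ≡ x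
enumerate-surjective (inside ∷ S) here = zero , refl
enumerate-surjective (inside ∷ S) (there x∈S) with enumerate-surjective S x∈S
... | i , refl = suc i , refl
enumerate-surjective (outside ∷ S) (there x∈S) with enumerate-surjective S x∈S
... | i , refl = i , refl

Fin-distinct⇒2≤ : ∀ {k} {i j : Fin k} → i ≢ j → 2 ≤ k
Fin-distinct⇒2≤ {suc zero}    {zero} {zero} i≢j = ⊥-elim (i≢j refl)
Fin-distinct⇒2≤ {suc (suc k)} i≢j = s≤s (s≤s z≤n)

2≤∣S∣ : (S : Subset n) → ∀ {x y} → x ∈ S → y ∈ S → x ≢ y → 2 ≤ ∣ S ∣
2≤∣S∣ S x∈S y∈S x≢y with enumerate-surjective S x∈S | enumerate-surjective S y∈S
... | i , refl | j , refl = Fin-distinct⇒2≤ λ i≡j → x≢y (cong (enumerate S) i≡j)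

∣S∣≡0 : (S : Subset n) → (∀ x → x ∉ S) → ∣ S ∣ ≡ 0
∣S∣≡0 S x∉S with ∣ S ∣ | enumerate S | enumerate-∈ S
... | zero  | e | e∈ = refl
... | suc _ | e | e∈ = ⊥-elim (x∉S _ (e∈ zero))

another : (S : Subset n) → ∀ {x} → x ∈ S → (∣ S ∣ ≡ 0) ⊎ (2 ≤ ∣ S ∣) → ∃ λ y → y ∈ S × y ≢ x
-- The size is abstracted together with its enumeration, so that matching on it yields concrete
-- indices: one of `0F` and `1F` is not the index of `x`.
another S x∈S 0⊎2 with ∣ S ∣ | enumerate S | enumerate-∈ S | enumerate-injective S | enumerate-surjective S x∈S
another S x∈S (inj₁ refl)            | _           | e | e∈ | e-inj | () , _
another S x∈S (inj₂ (s≤s (s≤s _))) | suc (suc _) | e | e∈ | e-inj | zero , refl =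
  e 1F , e∈ 1F , λ eq → contradiction (e-inj eq) λ ()
another S x∈S (inj₂ (s≤s (s≤s _))) | suc (suc _) | e | e∈ | e-inj | suc i , refl =
  e 0F , e∈ 0F , λ eq → contradiction (e-inj eq) λ ()

pair : Fin n → Fin n → Subset n
pair a b = ⁅ a ⁆ ∪ ⁅ b ⁆

∈-pair⁻ : ∀ {a b x : Fin n} → x ∈ pair a b → x ≡ a ⊎ x ≡ b
∈-pair⁻ {a = a} {b} x∈ with x∈p∪q⁻ ⁅ a ⁆ ⁅ b ⁆ x∈
... | inj₁ x∈a = inj₁ (x∈⁅y⁆⇒x≡y a x∈a)
... | inj₂ x∈b = inj₂ (x∈⁅y⁆⇒x≡y b x∈b)

∈-pairˡ : ∀ {a b : Fin n} → a ∈ pair a b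
∈-pairˡ {a = a} = x∈p∪q⁺ (inj₁ (x∈⁅x⁆ a))

∈-pairʳ : ∀ {a b : Fin n} → b ∈ pair a b
∈-pairʳ {b = b} = x∈p∪q⁺ (inj₂ (x∈⁅x⁆ b))

∣pair∣≡2 : ∀ {a b : Fin n} → a ≢ b → ∣ pair a b ∣ ≡ 2
∣pair∣≡2 {n} {a} {b} a≢b = ≤-antisym (injective⇒≤ index-injective) (2≤∣S∣ S ∈-pairˡ ∈-pairʳ a≢b)
  where
  S : Subset n
  S = pair a b
  index : Fin ∣ S ∣ → Fin 2
  index i with enumerate S i ≟ a
  ... | yes _ = 0F
  ... | no  _ = 1F
  index-injective : Injective _≡_ _≡_ index
  index-injective {i} {j} eq with enumerate S i ≟ a | enumerate S j ≟ a
  ... | yes p | yes q = enumerate-injective S (trans p (sym q))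
  ... | no  p | no  q with ∈-pair⁻ (enumerate-∈ S i) | ∈-pair⁻ (enumerate-∈ S j)
  ...   | inj₁ r | _      = contradiction r p
  ...   | inj₂ _ | inj₁ r = contradiction r q
  ...   | inj₂ r | inj₂ t = enumerate-injective S (trans r (sym t))

∈-∁pair⁺ : ∀ {a b v : Fin n} → v ≢ a → v ≢ b → v ∈ ∁ (pair a b)
∈-∁pair⁺ v≢a v≢b = x∉p⇒x∈∁p λ v∈ → [ v≢a , v≢b ]′ (∈-pair⁻ v∈)

∉-∁pair⁻ : ∀ {a b v : Fin n} → v ∉ ∁ (pair a b) → v ≡ a ⊎ v ≡ b
∉-∁pair⁻ v∉ = ∈-pair⁻ (x∉∁p⇒x∈p v∉)

a∉∁pair : ∀ {a b : Fin n} → a ∉ ∁ (pair a b)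
a∉∁pair = x∈p⇒x∉∁p ∈-pairˡ

b∉∁pair : ∀ {a b : Fin n} → b ∉ ∁ (pair a b)
b∉∁pair = x∈p⇒x∉∁p ∈-pairʳ

∣∁pair∣≡n∸2 : ∀ {a b : Fin n} → a ≢ b → ∣ ∁ (pair a b) ∣ ≡ n ∸ 2
∣∁pair∣≡n∸2 {n} {a} {b} a≢b = trans (∣∁p∣≡n∸∣p∣ (pair a b)) (cong (n ∸_) (∣pair∣≡2 a≢b))

∣S∣≡n∸2⇒pair : (S : Subset n) → 2 ≤ n → ∣ S ∣ ≡ n ∸ 2 →
  ∃₂ λ a b → a ≢ b × a ∉ S × b ∉ S × (∀ v → v ∉ S → v ≡ a ⊎ v ≡ b)
∣S∣≡n∸2⇒pair S 2≤n eq
  -- From `2 ≤ n` follows `n ∸ (n ∸ 2) ≡ 2`; with this size the enumeration of `∁ S` names the two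
  -- missing vertices.
  with ∣ ∁ S ∣ | trans (∣∁p∣≡n∸∣p∣ S) (trans (cong (_ ∸_) eq) (m∸[m∸n]≡n 2≤n))
     | enumerate (∁ S) | enumerate-∈ (∁ S) | enumerate-injective (∁ S) | (λ {x} → enumerate-surjective (∁ S) {x})
... | _ | refl | e | e∈ | e-inj | e-surj =
  e 0F , e 1F , (λ eq → contradiction (e-inj eq) λ ()) , x∈∁p⇒x∉p (e∈ 0F) , x∈∁p⇒x∉p (e∈ 1F) , cover
  where
  cover : ∀ v → v ∉ S → v ≡ e 0F ⊎ v ≡ e 1F
  cover v v∉S with e-surj (x∉p⇒x∈∁p v∉S)
  ... | 0F , p = inj₁ (sym p)
  ... | 1F , p = inj₂ (sym p)

2≤∣∁S∣⇒∣S∣≤n∸2 : (S : Subset n) → 2 ≤ ∣ ∁ S ∣ → ∣ S ∣ ≤ n ∸ 2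
2≤∣∁S∣⇒∣S∣≤n∸2 {n} S 2≤ = ≤-trans (≤-reflexive (sym (m∸[m∸n]≡n (∣p∣≤n S))))
  (∸-monoʳ-≤ n (subst (2 ≤_) (∣∁p∣≡n∸∣p∣ S) 2≤))

-- Assembling isomorphisms from blocks

↑ˡ≢↑ʳ : ∀ {a b} (i : Fin a) (j : Fin b) → i ↑ˡ b ≢ a ↑ʳ j
↑ˡ≢↑ʳ {a} {b} i j eq
  with trans (sym (splitAt-↑ˡ a i b)) (trans (cong (splitAt a) eq) (splitAt-↑ʳ a b j))
... | ()

splitAt-injective : ∀ a {b} {x y : Fin (a + b)} → splitAt a x ≡ splitAt a y → x ≡ y
splitAt-injective a {b} {x} {y} eq =
  trans (sym (join-splitAt a b x)) (trans (cong (Data.Fin.join a b) eq) (join-splitAt a b y))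

glue : ∀ {a b} → (Fin a → Fin n) → (Fin b → Fin n) → Fin (a + b) → Fin n
glue {a = a} p q x = [ p , q ]′ (splitAt a x)

module _ {a b} {p : Fin a → Fin n} {q : Fin b → Fin n} where

  glue-↑ˡ : ∀ i → glue p q (i ↑ˡ b) ≡ p i
  glue-↑ˡ i = cong [ p , q ]′ (splitAt-↑ˡ a i b)

  glue-↑ʳ : ∀ j → glue p q (a ↑ʳ j) ≡ q j
  glue-↑ʳ j = cong [ p , q ]′ (splitAt-↑ʳ a b j)

  glue-injective : Injective _≡_ _≡_ p → Injective _≡_ _≡_ q → (∀ i j → p i ≢ q j) →
    Injective _≡_ _≡_ (glue p q)
  glue-injective p-inj q-inj p≢q {x} {y} eq = splitAt-injective a (inj (splitAt a x) (splitAt a y) eq)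
    where
    inj : ∀ s t → [ p , q ]′ s ≡ [ p , q ]′ t → s ≡ t
    inj (inj₁ i) (inj₁ j) eq = cong inj₁ (p-inj eq)
    inj (inj₁ i) (inj₂ j) eq = ⊥-elim (p≢q i j eq)
    inj (inj₂ i) (inj₁ j) eq = ⊥-elim (p≢q j i (sym eq))
    inj (inj₂ i) (inj₂ j) eq = cong inj₂ (q-inj eq)

  glue-surjective : ∀ {v} → (∃ λ i → p i ≡ v) ⊎ (∃ λ j → q j ≡ v) → ∃ λ x → glue p q x ≡ v
  glue-surjective (inj₁ (i , refl)) = i ↑ˡ b , glue-↑ˡ i
  glue-surjective (inj₂ (j , refl)) = a ↑ʳ j , glue-↑ʳ j

  -- `blocks` stores one of the two off-diagonal blocks; the symmetry of `G` accounts for the other.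
  blocks-glue : ∀ {A : Graph a} {B : Fin a → Fin b → Bool} {C : Graph b} {G : Graph n} →
    (∀ x y → G x y ≡ G y x) →
    (∀ i j → A i j ≡ G (p i) (p j)) → (∀ i j → B i j ≡ G (p i) (q j)) → (∀ i j → C i j ≡ G (q i) (q j)) →
    ∀ x y → blocks A B C x y ≡ G (glue p q x) (glue p q y)
  blocks-glue G-sym A≡ B≡ C≡ x y with splitAt a x | splitAt a y
  ... | inj₁ i | inj₁ j = A≡ i j
  ... | inj₁ i | inj₂ j = B≡ i j
  ... | inj₂ i | inj₁ j = trans (B≡ j i) (G-sym _ _)
  ... | inj₂ i | inj₂ j = C≡ i j

injective∧surjective⇒↔ : ∀ {k} (f : Fin k → Fin n) → Injective _≡_ _≡_ f → (∀ v → ∃ λ x → f x ≡ v) →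
  Fin k ↔ Fin n
injective∧surjective⇒↔ f f-inj f-surj = mk↔ₛ′ f (proj₁ ∘ f-surj) (proj₂ ∘ f-surj)
  λ x → f-inj (proj₂ (f-surj (f x)))

module _ {a b} (A : Graph a) (B : Fin a → Fin b → Bool) (C : Graph b) where

  blocks-ˡʳ : ∀ i j → blocks A B C (i ↑ˡ b) (a ↑ʳ j) ≡ B i j
  blocks-ˡʳ i j rewrite splitAt-↑ˡ a i b | splitAt-↑ʳ a b j = refl

  blocks-ʳʳ : ∀ i j → blocks A B C (a ↑ʳ i) (a ↑ʳ j) ≡ C i j
  blocks-ʳʳ i j rewrite splitAt-↑ʳ a b i | splitAt-↑ʳ a b j = refl

-- The neighbourhood, in corona H, of the vertex added to form a simple diadem
-- (closed = false) or a diadem (closed = true).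
record TopNbrs {m} (closed : Bool) (i₀ : Fin m) (N : Fin (m + m) → Bool) : Set where
  field
    N-supp : ∀ i → N (i ↑ˡ m) ≡ ⌊ i ≟ i₀ ⌋
    N-leaf : ∀ i → N (m ↑ʳ i) ≡ closed ∧ ⌊ i ≟ i₀ ⌋

simpleDiadem-topNbrs : ∀ {m} (s : Fin m) → TopNbrs false s (λ x → ⌊ x ≟ (s ↑ˡ m) ⌋)
simpleDiadem-topNbrs {m} s = record
  { N-supp = λ i → ⌊⌋-cong (_ ≟ _) (_ ≟ _) (↑ˡ-injective m i s) (cong (_↑ˡ m))
  ; N-leaf = λ i → ¬T⇒≡false λ t → ↑ˡ≢↑ʳ s i (sym (toWitness t))
  }

diadem-topNbrs : ∀ {m} (s : Fin m) → TopNbrs true s (λ x → ⌊ x ≟ (s ↑ˡ m) ⌋ ∨ ⌊ x ≟ (m ↑ʳ s) ⌋)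
diadem-topNbrs {m} s = record
  { N-supp = λ i → ⌊⌋-∨ (_ ≟ _) (_ ≟ _) (i ≟ s)
      (↑ˡ-injective m i s) (⊥-elim ∘ ↑ˡ≢↑ʳ i s) (inj₁ ∘ cong (_↑ˡ m))
  ; N-leaf = λ i → ⌊⌋-∨ (_ ≟ _) (_ ≟ _) (i ≟ s)
      (⊥-elim ∘ ↑ˡ≢↑ʳ s i ∘ sym) (↑ʳ-injective m i s) (inj₂ ∘ cong (m ↑ʳ_))
  }

-- The flag is later `G a b`, so that one argument covers both joins.
hubs : Bool → Graph 2
hubs true  = complete 2
hubs false = edgeless 2

hubs-01 : ∀ c → hubs c 0F 1F ≡ c
hubs-01 true  = refl
hubs-01 false = refl

hubs-10 : ∀ c → hubs c 1F 0F ≡ c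
hubs-10 true  = refl
hubs-10 false = refl

hubs-irrefl : ∀ c i → hubs c i i ≡ false
hubs-irrefl true  0F = refl
hubs-irrefl true  1F = refl
hubs-irrefl false i  = refl

module SimpleGraph {n : ℕ} (G : Graph n) (simple : IsSimple G) where

  Adj-sym : ∀ {u v} → Adj G u v → Adj G v u
  Adj-sym {u} {v} = subst T (proj₁ simple u v)

  Adj-irrefl : ∀ {v} → ¬ Adj G v v
  Adj-irrefl {v} = subst T (proj₂ simple v)

  Reach-closed : (P : Fin n → Set) → (∀ {u w} → P u → Adj G u w → P w) →
    ∀ {u v} → Reach G u v → P u → P v
  Reach-closed P closed here         pu = pu
  Reach-closed P closed (step uw wv) pu = Reach-closed P closed wv (closed pu uw)

  -- Certified sets without counting

  IsOutNbr : Subset n → Fin n → Fin n → Set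
  IsOutNbr D v u = Adj G v u × u ∉ D

  ∈-outNbrs⁺ : ∀ {D v u} → IsOutNbr D v u → u ∈ outNbrs G D v
  ∈-outNbrs⁺ {D} {v} {u} (vu , u∉D) = lookup⇒[]= u _
    (trans (lookup∘tabulate _ u) (cong₂ _∧_ (Equivalence.to T-≡ vu) (cong not D[u]≡false)))
    where
    D[u]≡false : lookup D u ≡ false
    D[u]≡false = ¬T⇒≡false (λ t → u∉D (lookup⇒[]= u D (Equivalence.to T-≡ t)))

  ∈-outNbrs⁻ : ∀ {D v u} → u ∈ outNbrs G D v → IsOutNbr D v u
  ∈-outNbrs⁻ {D} {v} {u} u∈
    with Equivalence.to T-∧ (Equivalence.from T-≡ (trans (sym (lookup∘tabulate _ u)) ([]=⇒lookup u∈)))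
  ... | vu , t = vu , λ u∈D →
    contradiction (trans (sym ([]=⇒lookup u∈D)) (Equivalence.to T-not-≡ t)) λ ()

  zero-or-two⇒certified : ∀ {D} →
    (∀ v → v ∈ D → (∀ u → ¬ IsOutNbr D v u) ⊎ (∃₂ λ x y → x ≢ y × IsOutNbr D v x × IsOutNbr D v y)) →
    IsCertified G D
  zero-or-two⇒certified {D} h v v∈D with h v v∈D
  ... | inj₁ none = inj₁ (∣S∣≡0 (outNbrs G D v) λ u u∈ → none u (∈-outNbrs⁻ u∈))
  ... | inj₂ (x , y , x≢y , x-out , y-out) =
    inj₂ (2≤∣S∣ (outNbrs G D v) (∈-outNbrs⁺ x-out) (∈-outNbrs⁺ y-out) x≢y)

  second-outNbr : ∀ {D v u} → IsCertified G D → v ∈ D → IsOutNbr D v u →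
    ∃ λ w → w ≢ u × IsOutNbr D v w
  second-outNbr {D} {v} cert v∈D u-out
    with another (outNbrs G D v) (∈-outNbrs⁺ u-out) (cert v v∈D)
  ... | w , w∈ , w≢u = w , w≢u , ∈-outNbrs⁻ w∈

  -- The upper bound is automatic: a proper certified dominating set misses a vertex,
  -- and the vertex dominating it must miss a second one.
  ∁pair-minimal⇒Γ≡n∸2 : ∀ {a b} → a ≢ b → IsCertDom G (∁ (pair a b)) →
    (∀ D → a ∉ D → b ∉ D → IsCertDom G D → ∀ v → v ≢ a → v ≢ b → v ∈ D) →
    GammaCerIs G (n ∸ 2)
  ∁pair-minimal⇒Γ≡n∸2 {a} {b} a≢b certDom least =
    (D₀ , (certDom , D₀-minimal) , ∣∁pair∣≡n∸2 a≢b) , upper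
    where
    D₀ : Subset n
    D₀ = ∁ (pair a b)
    D₀-minimal : ∀ D → D ⊂ D₀ → ¬ IsCertDom G D
    D₀-minimal D (D⊆D₀ , v , v∈D₀ , v∉D) cd = v∉D
      (least D (a∉∁pair ∘ D⊆D₀) (b∉∁pair ∘ D⊆D₀) cd v
        (λ { refl → a∉∁pair v∈D₀ }) (λ { refl → b∉∁pair v∈D₀ }))
    upper : ∀ D → IsMinimalCertDom G D → ∣ D ∣ ≤ n ∸ 2
    upper D ((dom , cert) , D-min) with any? (λ v → ¬? (v ∈? D))
    -- If `D` is the whole vertex set, then `D₀` is a proper certified dominating subset, against
    -- minimality.
    ... | no all∈ = contradiction certDom (D-min D₀ ((λ {x} _ → ∈D x) , a , ∈D a , a∉∁pair))
      where
      ∈D : ∀ x → x ∈ D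
      ∈D x = decidable-stable (x ∈? D) λ x∉D → all∈ (x , x∉D)
    ... | yes (v , v∉D) with dom v v∉D
    ...   | u , u∈D , vu with second-outNbr cert u∈D (Adj-sym vu , v∉D)
    ...     | w , w≢v , _ , w∉D =
      2≤∣∁S∣⇒∣S∣≤n∸2 D (2≤∣S∣ (∁ D) (x∉p⇒x∈∁p w∉D) (x∉p⇒x∈∁p v∉D) w≢v)

  -- The extremal graphs, described inside `G`.

  record TwinHubs (joined : Bool) : Set where
    field
      a b     : Fin n
      a≢b     : a ≢ b
      a-b     : G a b ≡ joined
      hub-a   : ∀ {v} → v ≢ a → v ≢ b → Adj G v a
      hub-b   : ∀ {v} → v ≢ a → v ≢ b → Adj G v b
      others  : ∀ {u v} → u ≢ a → u ≢ b → v ≢ a → v ≢ b → ¬ Adj G u v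

  -- A diadem if `closed` is true, a simple diadem otherwise: `top` is the vertex added at the
  -- support `supp i₀`. Edges between supports are unrestricted, since they form the base graph of
  -- the corona.
  record Crown (closed : Bool) : Set where
    field
      m           : ℕ
      supp leaf   : Fin m → Fin n
      top         : Fin n
      i₀          : Fin m
      supp-inj    : Injective _≡_ _≡_ supp
      leaf-inj    : Injective _≡_ _≡_ leaf
      supp≢leaf   : ∀ i j → supp i ≢ leaf j
      top≢supp    : ∀ i → top ≢ supp i
      top≢leaf    : ∀ i → top ≢ leaf i
      cover       : ∀ v → v ≡ top ⊎ (∃ λ i → supp i ≡ v) ⊎ (∃ λ i → leaf i ≡ v)
      leaf-leaf   : ∀ i j → G (leaf i) (leaf j) ≡ false
      supp-leaf   : ∀ i j → G (supp i) (leaf j) ≡ ⌊ i ≟ j ⌋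
      top-supp    : ∀ i → G top (supp i) ≡ ⌊ i ≟ i₀ ⌋
      top-leaf    : ∀ i → G top (leaf i) ≡ closed ∧ ⌊ i ≟ i₀ ⌋

  -- Sufficiency: both families attain `n ∸ 2`.

  TwinHubs⇒Γ≡n∸2 : ∀ {c} → 3 ≤ n → TwinHubs c → GammaCerIs G (n ∸ 2)
  TwinHubs⇒Γ≡n∸2 3≤n hubs = ∁pair-minimal⇒Γ≡n∸2 a≢b (dom , cert) least
    where
    open TwinHubs hubs
    D₀ : Subset n
    D₀ = ∁ (pair a b)
    ∈D₀⇒≢a : ∀ {v} → v ∈ D₀ → v ≢ a
    ∈D₀⇒≢a v∈ refl = a∉∁pair v∈
    ∈D₀⇒≢b : ∀ {v} → v ∈ D₀ → v ≢ b
    ∈D₀⇒≢b v∈ refl = b∉∁pair v∈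
    -- Here `3 ≤ n` enters: `D₀` has `n ∸ 2` elements, so it is not empty.
    third : ∃ λ v → v ∈ D₀
    third with any? (λ v → v ∈? D₀)
    ... | yes p = p
    ... | no none = contradiction (trans (sym (∣∁pair∣≡n∸2 a≢b)) (∣S∣≡0 D₀ λ v v∈ → none (v , v∈))) (n∸2≢0 3≤n)
      where
      n∸2≢0 : ∀ {k} → 3 ≤ k → k ∸ 2 ≢ 0
      n∸2≢0 (s≤s (s≤s (s≤s _))) ()
    dom : IsDominating G D₀
    dom v v∉ with third | ∉-∁pair⁻ v∉
    ... | w , w∈ | inj₁ refl = w , w∈ , Adj-sym (hub-a (∈D₀⇒≢a w∈) (∈D₀⇒≢b w∈))
    ... | w , w∈ | inj₂ refl = w , w∈ , Adj-sym (hub-b (∈D₀⇒≢a w∈) (∈D₀⇒≢b w∈))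
    cert : IsCertified G D₀
    cert = zero-or-two⇒certified λ v v∈ → inj₂ (a , b , a≢b ,
      (hub-a (∈D₀⇒≢a v∈) (∈D₀⇒≢b v∈) , a∉∁pair) , (hub-b (∈D₀⇒≢a v∈) (∈D₀⇒≢b v∈) , b∉∁pair))
    least : ∀ D → a ∉ D → b ∉ D → IsCertDom G D → ∀ v → v ≢ a → v ≢ b → v ∈ D
    -- Only hubs are adjacent to `v`, so a dominating set that misses both hubs must contain `v`
    -- itself.
    least D a∉D b∉D (D-dom , _) v v≢a v≢b = decidable-stable (v ∈? D) λ v∉D →
      let u , u∈D , vu = D-dom v v∉D in
      others v≢a v≢b (λ { refl → a∉D u∈D }) (λ { refl → b∉D u∈D }) vu

  -- In `D₀` only `supp i₀` sees `leaf i₀` or `top`, and it sees both, so `D₀` is certified. For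
  -- leastness, the supports are recovered first and the remaining leaves from them.
  Crown⇒Γ≡n∸2 : ∀ {c} → Crown c → GammaCerIs G (n ∸ 2)
  Crown⇒Γ≡n∸2 {c} crown = ∁pair-minimal⇒Γ≡n∸2 (top≢leaf i₀ ∘ sym) (dom , zero-or-two⇒certified cert) least
    where
    open Crown crown
    D₀ : Subset n
    D₀ = ∁ (pair (leaf i₀) top)

    supp∈D₀ : ∀ i → supp i ∈ D₀
    supp∈D₀ i = ∈-∁pair⁺ (supp≢leaf i i₀) (top≢supp i ∘ sym)

    supp-leaf-adj : ∀ i → Adj G (supp i) (leaf i)
    supp-leaf-adj i = subst T (sym (supp-leaf i i)) (fromWitness refl)

    top-supp-adj : Adj G top (supp i₀)
    top-supp-adj = subst T (sym (top-supp i₀)) (fromWitness refl)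

    top-nbr : ∀ {v} → Adj G top v → v ≡ supp i₀ ⊎ v ≡ leaf i₀
    top-nbr {v} tv with cover v
    ... | inj₁ refl = ⊥-elim (Adj-irrefl tv)
    ... | inj₂ (inj₁ (i , refl)) = inj₁ (cong supp (toWitness (subst T (top-supp i) tv)))
    ... | inj₂ (inj₂ (i , refl)) =
      inj₂ (cong leaf (toWitness (proj₂ (Equivalence.to (T-∧ {c}) (subst T (top-leaf i) tv)))))

    leaf-nbr : ∀ {i v} → Adj G (leaf i) v → v ≡ supp i ⊎ (v ≡ top × i ≡ i₀)
    leaf-nbr {i} {v} lv with cover v
    ... | inj₁ refl with top-nbr (Adj-sym lv)
    ...   | inj₁ eq = ⊥-elim (supp≢leaf i₀ i (sym eq))
    ...   | inj₂ eq = inj₂ (refl , leaf-inj eq)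
    leaf-nbr {i} {v} lv | inj₂ (inj₁ (j , refl)) =
      inj₁ (cong supp (toWitness (subst T (supp-leaf j i) (Adj-sym lv))))
    leaf-nbr {i} {v} lv | inj₂ (inj₂ (j , refl)) = ⊥-elim (subst T (leaf-leaf i j) lv)

    dom : IsDominating G D₀
    dom v v∉ with ∉-∁pair⁻ v∉
    ... | inj₁ refl = supp i₀ , supp∈D₀ i₀ , Adj-sym (supp-leaf-adj i₀)
    ... | inj₂ refl = supp i₀ , supp∈D₀ i₀ , top-supp-adj

    cert : ∀ v → v ∈ D₀ →
      (∀ u → ¬ IsOutNbr D₀ v u) ⊎ (∃₂ λ x y → x ≢ y × IsOutNbr D₀ v x × IsOutNbr D₀ v y)
    cert v v∈ with v ≟ supp i₀
    ... | yes refl = inj₂ (leaf i₀ , top , top≢leaf i₀ ∘ sym ,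
      (supp-leaf-adj i₀ , a∉∁pair) , (Adj-sym top-supp-adj , b∉∁pair))
    ... | no v≢s = inj₁ none
      where
      none : ∀ u → ¬ IsOutNbr D₀ v u
      none u (vu , u∉) with ∉-∁pair⁻ u∉
      ... | inj₁ refl with leaf-nbr (Adj-sym vu)
      ...   | inj₁ eq = v≢s eq
      ...   | inj₂ (refl , _) = b∉∁pair v∈
      none u (vu , u∉) | inj₂ refl with top-nbr (Adj-sym vu)
      ...   | inj₁ eq = v≢s eq
      ...   | inj₂ refl = a∉∁pair v∈

    least : ∀ D → leaf i₀ ∉ D → top ∉ D → IsCertDom G D → ∀ v → v ≢ leaf i₀ → v ≢ top → v ∈ D
    least D a∉D b∉D (D-dom , D-cert) = covered
      where
      leaf∉⇒supp∈ : ∀ i → leaf i ∉ D → supp i ∈ D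
      leaf∉⇒supp∈ i l∉D with D-dom (leaf i) l∉D
      ... | u , u∈D , lu with leaf-nbr lu
      ...   | inj₁ refl = u∈D
      ...   | inj₂ (refl , _) = ⊥-elim (b∉D u∈D)

      -- A leaf outside `D` can only be dominated by its support, as `top` is missing too; a leaf
      -- inside `D` would have a missing support as its only outside neighbour.
      supp∈D : ∀ i → supp i ∈ D
      supp∈D i with leaf i ∈? D
      ... | no l∉D = leaf∉⇒supp∈ i l∉D
      ... | yes l∈D = decidable-stable (supp i ∈? D) λ s∉D →
        case (second-outNbr D-cert l∈D (Adj-sym (supp-leaf-adj i) , s∉D))
        where
        case : ¬ (∃ λ w → w ≢ supp i × IsOutNbr D (leaf i) w)
        case (w , w≢s , lw , w∉D) with leaf-nbr lw
        ... | inj₁ eq = w≢s eq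
        ... | inj₂ (_ , refl) = a∉D l∈D

      -- Since all supports lie in `D` and `top` is attached at `i₀`, a missing leaf would be the
      -- only outside neighbour of its support.
      leaf∈D : ∀ i → i ≢ i₀ → leaf i ∈ D
      leaf∈D i i≢i₀ = decidable-stable (leaf i ∈? D) λ l∉D →
        case (second-outNbr D-cert (supp∈D i) (supp-leaf-adj i , l∉D))
        where
        case : ¬ (∃ λ w → w ≢ leaf i × IsOutNbr D (supp i) w)
        case (w , w≢l , sw , w∉D) with cover w
        ... | inj₁ refl = i≢i₀ (toWitness (subst T (top-supp i) (Adj-sym sw)))
        ... | inj₂ (inj₁ (j , refl)) = w∉D (supp∈D j)
        ... | inj₂ (inj₂ (j , refl)) = w≢l (cong leaf (sym (toWitness (subst T (supp-leaf i j) sw))))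

      covered : ∀ v → v ≢ leaf i₀ → v ≢ top → v ∈ D
      covered v v≢a v≢b with cover v
      ... | inj₁ eq = ⊥-elim (v≢b eq)
      ... | inj₂ (inj₁ (i , refl)) = supp∈D i
      ... | inj₂ (inj₂ (i , refl)) = leaf∈D i λ { refl → v≢a refl }

  -- Passage between these descriptions and isomorphisms.

  Iso⇒Crown : ∀ {m c} {H : Graph m} {i₀ N} → TopNbrs c i₀ N → Iso (extend (corona H) N) G → Crown c
  Iso⇒Crown {m} {c} {H} {i₀} {N} topNbrs (f , f-hom) = record
    { m = m ; supp = supp ; leaf = leaf ; top = to zero ; i₀ = i₀
    ; supp-inj  = ↑ˡ-injective m _ _ ∘ Fin.suc-injective ∘ to-inj
    ; leaf-inj  = ↑ʳ-injective m _ _ ∘ Fin.suc-injective ∘ to-inj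
    ; supp≢leaf = λ i j → ↑ˡ≢↑ʳ i j ∘ Fin.suc-injective ∘ to-inj
    ; top≢supp  = λ i eq → contradiction (to-inj eq) λ ()
    ; top≢leaf  = λ i eq → contradiction (to-inj eq) λ ()
    ; cover     = cover
    ; leaf-leaf = λ i j → trans (sym (f-hom _ _)) (blocks-ʳʳ H _ _ i j)
    ; supp-leaf = λ i j → trans (sym (f-hom _ _)) (blocks-ˡʳ H _ _ i j)
    ; top-supp  = λ i → trans (sym (f-hom _ _)) (TopNbrs.N-supp topNbrs i)
    ; top-leaf  = λ i → trans (sym (f-hom _ _)) (TopNbrs.N-leaf topNbrs i)
    }
    where
    open Inverse f using (to; from; strictlyInverseˡ)
    to-inj : Injective _≡_ _≡_ to
    to-inj = Injection.injective (↔⇒↣ f)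
    supp leaf : Fin m → Fin n
    supp i = to (suc (i ↑ˡ m))
    leaf i = to (suc (m ↑ʳ i))
    cover : ∀ v → v ≡ to zero ⊎ (∃ λ i → supp i ≡ v) ⊎ (∃ λ i → leaf i ≡ v)
    cover v with from v | strictlyInverseˡ v
    ... | zero  | eq = inj₁ (sym eq)
    ... | suc x | eq with splitAt m x | join-splitAt m m x
    ...   | inj₁ i | refl = inj₂ (inj₁ (i , eq))
    ...   | inj₂ i | refl = inj₂ (inj₂ (i , eq))

  Crown⇒Iso : ∀ {c} (crown : Crown c) → let open Crown crown in
    Σ (Graph m) λ H → IsSimple H × (∀ {N} → TopNbrs c i₀ N → Iso (extend (corona H) N) G)
  Crown⇒Iso {c} crown = H , ((λ i j → proj₁ simple _ _) , (λ i → proj₂ simple _)) , iso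
    where
    open Crown crown
    H : Graph m
    H i j = G (supp i) (supp j)
    low : Fin (m + m) → Fin n
    low = glue supp leaf
    top≢low : ∀ x → top ≢ low x
    top≢low x with splitAt m x
    ... | inj₁ i = top≢supp i
    ... | inj₂ i = top≢leaf i
    f : Fin (suc (m + m)) → Fin n
    -- `extend` puts the new vertex at `zero`; reading `suc (m + m)` as `1 + (m + m)` lets `glue`
    -- place it.
    f = glue {a = 1} (λ _ → top) low
    f-surjective : ∀ v → ∃ λ x → f x ≡ v
    f-surjective v with cover v
    ... | inj₁ refl = zero , refl
    ... | inj₂ v-low with glue-surjective v-low
    ...   | x , eq = suc x , eq
    iso : ∀ {N} → TopNbrs c i₀ N → Iso (extend (corona H) N) G
    iso {N} topNbrs = injective∧surjective⇒↔ f
      (glue-injective {a = 1} (λ { {0F} {0F} _ → refl }) (glue-injective supp-inj leaf-inj supp≢leaf) λ _ → top≢low)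
      f-surjective , hom
      where
      open TopNbrs topNbrs
      N≡ : ∀ x → N x ≡ G top (low x)
      N≡ x with splitAt m x | join-splitAt m m x
      ... | inj₁ i | refl = trans (N-supp i) (sym (top-supp i))
      ... | inj₂ i | refl = trans (N-leaf i) (sym (top-leaf i))
      hom : ∀ x y → extend (corona H) N x y ≡ G (f x) (f y)
      hom zero    zero    = sym (proj₂ simple top)
      hom zero    (suc y) = N≡ y
      hom (suc x) zero    = trans (N≡ x) (proj₁ simple _ _)
      hom (suc x) (suc y) = blocks-glue {p = supp} {leaf} {G = G} (proj₁ simple)
        (λ _ _ → refl) (λ i j → sym (supp-leaf i j)) (λ i j → sym (leaf-leaf i j)) x y

  Iso⇒TwinHubs : ∀ {c k} → Iso (join (hubs c) (edgeless k)) G → TwinHubs c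
  Iso⇒TwinHubs {c} {k} (f , f-hom) = record
    { a = to 0F ; b = to 1F
    ; a≢b    = λ eq → contradiction (to-inj eq) λ ()
    ; a-b    = trans (sym (f-hom _ _)) (hubs-01 c)
    ; hub-a  = λ {v} v≢a v≢b → hub-a v (view v v≢a v≢b)
    ; hub-b  = λ {v} v≢a v≢b → hub-b v (view v v≢a v≢b)
    ; others = λ {u} {v} u≢a u≢b v≢a v≢b → others u v (view u u≢a u≢b) (view v v≢a v≢b)
    }
    where
    open Inverse f using (to; from; strictlyInverseˡ)
    to-inj : Injective _≡_ _≡_ to
    to-inj = Injection.injective (↔⇒↣ f)
    Other : Fin n → Set
    Other v = ∃ λ (j : Fin k) → to (suc (suc j)) ≡ v
    view : ∀ v → v ≢ to 0F → v ≢ to 1F → Other v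
    view v v≢a v≢b with from v | strictlyInverseˡ v
    ... | 0F          | eq = ⊥-elim (v≢a (sym eq))
    ... | 1F          | eq = ⊥-elim (v≢b (sym eq))
    ... | suc (suc j) | eq = j , eq
    hub-a : ∀ v → Other v → Adj G v (to 0F)
    -- On these indices the join computes to `true`, so its edge has the trivial proof.
    hub-a v (j , refl) = subst T (f-hom _ _) _
    hub-b : ∀ v → Other v → Adj G v (to 1F)
    hub-b v (j , refl) = subst T (f-hom _ _) _
    others : ∀ u v → Other u → Other v → ¬ Adj G u v
    others u v (i , refl) (j , refl) uv = subst T (sym (f-hom _ _)) uv

  TwinHubs⇒Iso : ∀ {c} → TwinHubs c → Iso (join (hubs c) (edgeless (n ∸ 2))) G
  -- The edgeless part is indexed by the enumeration of `D₀`, whose size is then replaced by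
  -- `n ∸ 2`.
  TwinHubs⇒Iso {c} twins = subst (λ k → Iso (join (hubs c) (edgeless k)) G) (∣∁pair∣≡n∸2 a≢b)
    (injective∧surjective⇒↔ (glue ab q)
      (glue-injective {p = ab} ab-inj (enumerate-injective D₀) ab≢q) surj , blocks-glue (proj₁ simple) hubs≡
        (λ i j → sym (Equivalence.to T-≡ (ab-q i j))) (λ i j → sym (¬T⇒≡false (q-q i j))))
    where
    open TwinHubs twins
    D₀ : Subset n
    D₀ = ∁ (pair a b)
    ab : Fin 2 → Fin n
    ab 0F = a
    ab 1F = b
    q : Fin ∣ D₀ ∣ → Fin n
    q = enumerate D₀
    q≢a : ∀ j → q j ≢ a
    q≢a j eq = a∉∁pair (subst (_∈ D₀) eq (enumerate-∈ D₀ j))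
    q≢b : ∀ j → q j ≢ b
    q≢b j eq = b∉∁pair (subst (_∈ D₀) eq (enumerate-∈ D₀ j))
    ab-inj : Injective _≡_ _≡_ ab
    ab-inj {0F} {0F} eq = refl
    ab-inj {0F} {1F} eq = ⊥-elim (a≢b eq)
    ab-inj {1F} {0F} eq = ⊥-elim (a≢b (sym eq))
    ab-inj {1F} {1F} eq = refl
    ab≢q : ∀ i j → ab i ≢ q j
    ab≢q 0F j = q≢a j ∘ sym
    ab≢q 1F j = q≢b j ∘ sym
    surj : ∀ v → ∃ λ x → glue ab q x ≡ v
    surj v with v ∈? D₀
    ... | yes v∈ = glue-surjective (inj₂ (enumerate-surjective D₀ v∈))
    ... | no v∉ with ∉-∁pair⁻ v∉
    ...   | inj₁ eq = glue-surjective {p = ab} (inj₁ (0F , sym eq))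
    ...   | inj₂ eq = glue-surjective {p = ab} (inj₁ (1F , sym eq))
    hubs≡ : ∀ i j → hubs c i j ≡ G (ab i) (ab j)
    hubs≡ 0F 0F = trans (hubs-irrefl c 0F) (sym (proj₂ simple a))
    hubs≡ 0F 1F = trans (hubs-01 c) (sym a-b)
    hubs≡ 1F 0F = trans (hubs-10 c) (trans (sym a-b) (proj₁ simple a b))
    hubs≡ 1F 1F = trans (hubs-irrefl c 1F) (sym (proj₂ simple b))
    ab-q : ∀ i j → Adj G (ab i) (q j)
    ab-q 0F j = Adj-sym (hub-a (q≢a j) (q≢b j))
    ab-q 1F j = Adj-sym (hub-b (q≢a j) (q≢b j))
    q-q : ∀ i j → ¬ Adj G (q i) (q j)
    q-q i j = others (q≢a i) (q≢b i) (q≢a j) (q≢b j)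

  -- Greedy choice of independent vertices.

  abstract
    -- `F` is forced and may contain adjacent vertices; the candidates in `R` are scanned once, and
    -- one is added when it has no neighbour in the current set. A later addition therefore never
    -- becomes a neighbour of an earlier choice.
    greedyIndependent : {F R : Fin n → Set} → Decidable F → Decidable R → ∃ λ (S : Subset n) →
      (∀ {v} → F v → v ∈ S) ×
      (∀ {v} → v ∈ S → F v ⊎ (R v × (∀ {u} → u ∈ S → ¬ Adj G v u))) ×
      (∀ {v} → R v → v ∈ S ⊎ (∃ λ u → u ∈ S × Adj G v u))
    greedyIndependent {F} {R} F? R? =
      let S , F⊆S , indep , maximal = go (allFin n) in S , F⊆S , indep , λ {v} → maximal (∈-allFin v)
      where
      go : (vs : List (Fin n)) → ∃ λ (S : Subset n) →
        (∀ {v} → F v → v ∈ S) ×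
        (∀ {v} → v ∈ S → F v ⊎ (R v × (∀ {u} → u ∈ S → ¬ Adj G v u))) ×
        (∀ {v} → v List.∈ vs → R v → v ∈ S ⊎ (∃ λ u → u ∈ S × Adj G v u))
      go [] = comprehension F? , ∈-comprehension⁺ F? , inj₁ ∘ ∈-comprehension⁻ F? , λ ()
      go (x ∷ vs) with go vs
      ... | S , F⊆S , indep , maximal with R? x | x ∈? S | any? (λ u → (u ∈? S) ×-dec T? (G x u))
      ...   | no ¬Rx | _ | _ = S , F⊆S , indep ,
        λ { (here refl) Rx → ⊥-elim (¬Rx Rx) ; (there v∈) → maximal v∈ }
      ...   | yes _ | yes x∈S | _ = S , F⊆S , indep ,
        λ { (here refl) _ → inj₁ x∈S ; (there v∈) → maximal v∈ }
      ...   | yes _ | no _ | yes nbr = S , F⊆S , indep ,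
        λ { (here refl) _ → inj₂ nbr ; (there v∈) → maximal v∈ }
      ...   | yes Rx | no _ | no ¬nbr = S′ , S⊆S′ ∘ F⊆S , indep′ , maximal′
        where
        S′ : Subset n
        S′ = S ∪ ⁅ x ⁆
        S⊆S′ : ∀ {v} → v ∈ S → v ∈ S′
        S⊆S′ = x∈p∪q⁺ ∘ inj₁
        S′⁻ : ∀ {v} → v ∈ S′ → v ∈ S ⊎ v ≡ x
        S′⁻ = Data.Sum.map₂ (x∈⁅y⁆⇒x≡y x) ∘ x∈p∪q⁻ S ⁅ x ⁆
        x-isolated : ∀ {u} → u ∈ S′ → ¬ Adj G x u
        x-isolated u∈ xu with S′⁻ u∈
        ... | inj₁ u∈S = ¬nbr (_ , u∈S , xu)
        ... | inj₂ refl = Adj-irrefl xu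
        indep′ : ∀ {v} → v ∈ S′ → F v ⊎ (R v × (∀ {u} → u ∈ S′ → ¬ Adj G v u))
        indep′ v∈ with S′⁻ v∈
        ... | inj₂ refl = inj₂ (Rx , x-isolated)
        ... | inj₁ v∈S with indep v∈S
        ...   | inj₁ Fv = inj₁ Fv
        ...   | inj₂ (Rv , v-isolated) = inj₂ (Rv , λ u∈ vu →
          [ (λ u∈S → v-isolated u∈S vu) , (λ { refl → x-isolated v∈ (Adj-sym vu) }) ]′ (S′⁻ u∈))
        maximal′ : ∀ {v} → v List.∈ (x ∷ vs) → R v → v ∈ S′ ⊎ (∃ λ u → u ∈ S′ × Adj G v u)
        maximal′ (here refl) _ = inj₁ (x∈p∪q⁺ (inj₂ (x∈⁅x⁆ x)))
        maximal′ (there v∈) Rv with maximal v∈ Rv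
        ... | inj₁ v∈S = inj₁ (S⊆S′ v∈S)
        ... | inj₂ (u , u∈S , vu) = inj₂ (u , S⊆S′ u∈S , vu)

  -- A minimal certified dominating set whose complement is the pair `a`, `b`.

  module MissingPair (connected : Connected G) (D : Subset n)
    (D-dom : IsDominating G D) (D-cert : IsCertified G D) (D-min : ∀ D′ → D′ ⊂ D → ¬ IsCertDom G D′)
    (a b : Fin n) (a≢b : a ≢ b) (a∉D : a ∉ D) (b∉D : b ∉ D) (outside-D : ∀ v → v ∉ D → v ≡ a ⊎ v ≡ b)
    where

    D-least : ∀ D′ → D′ ⊆ D → IsCertDom G D′ → ∀ {v} → v ∈ D → v ∈ D′
    D-least D′ D′⊆D cd {v} v∈D = decidable-stable (v ∈? D′) λ v∉D′ → D-min D′ (D′⊆D , v , v∈D , v∉D′) cd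

    ∈D⇒≢a : ∀ {v} → v ∈ D → v ≢ a
    ∈D⇒≢a v∈D refl = a∉D v∈D

    ∈D⇒≢b : ∀ {v} → v ∈ D → v ≢ b
    ∈D⇒≢b v∈D refl = b∉D v∈D

    -- Certification demands a second outside neighbour, and only `b` is left.
    a-nbr⇒b-nbr : ∀ {v} → v ∈ D → Adj G v a → Adj G v b
    a-nbr⇒b-nbr v∈D va with second-outNbr D-cert v∈D (va , a∉D)
    ... | w , w≢a , vw , w∉D with outside-D w w∉D
    ...   | inj₁ eq = ⊥-elim (w≢a eq)
    ...   | inj₂ refl = vw

    b-nbr⇒a-nbr : ∀ {v} → v ∈ D → Adj G v b → Adj G v a
    b-nbr⇒a-nbr v∈D vb with second-outNbr D-cert v∈D (vb , b∉D)
    ... | w , w≢b , vw , w∉D with outside-D w w∉D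
    ...   | inj₁ refl = vw
    ...   | inj₂ eq = ⊥-elim (w≢b eq)

    -- A vertex of `D` that misses `a` also misses `b`, and nothing else lies outside `D`.
    nbr∈D : ∀ {v u} → v ∈ D → ¬ Adj G v a → Adj G v u → u ∈ D
    nbr∈D {v} {u} v∈D ¬va vu = decidable-stable (u ∈? D) λ u∉D →
      [ (λ { refl → ¬va vu }) , (λ { refl → ¬va (b-nbr⇒a-nbr v∈D vu) }) ]′ (outside-D u u∉D)

    -- Only degree-one vertices of `D` count here; `a` joins the leaves later, through `LeafOf`.
    Pendant : Fin n → Fin n → Set
    Pendant l p = l ∈ D × Adj G l p × (∀ u → Adj G l u → u ≡ p)

    abstract
      Pendant? : ∀ l p → Dec (Pendant l p)
      Pendant? l p = (l ∈? D) ×-dec T? (G l p) ×-dec all? λ u → T? (G l u) →-dec (u ≟ p)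

    IsLeaf IsSupport : Fin n → Set
    IsLeaf l    = ∃ λ p → Pendant l p
    IsSupport p = ∃ λ l → Pendant l p

    -- A leaf that sees `a` would see `b` as well and have two neighbours.
    leaf-¬a : ∀ {l p} → Pendant l p → ¬ Adj G l a
    leaf-¬a (l∈D , _ , only) la = a≢b (trans (only a la) (sym (only b (a-nbr⇒b-nbr l∈D la))))

    support∈D : ∀ {l p} → Pendant l p → p ∈ D
    support∈D pend@(l∈D , lp , _) = nbr∈D l∈D (leaf-¬a pend) lp

    -- Otherwise `l` and `p` would form a component of their own, although `a` is reachable from
    -- `l`.
    support-¬leaf : ∀ {l p q} → Pendant l p → ¬ Pendant p q
    support-¬leaf {l} {p} {q} lp@(l∈D , l-p , l-only) pq@(p∈D , p-q , p-only) =
      [ ∈D⇒≢a l∈D ∘ sym , ∈D⇒≢a p∈D ∘ sym ]′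
        (Reach-closed (λ v → v ≡ l ⊎ v ≡ p)
          (λ { (inj₁ refl) uw → inj₂ (l-only _ uw)
             ; (inj₂ refl) uw → inj₁ (trans (p-only _ uw) (sym (p-only _ (Adj-sym l-p)))) })
          (connected l a) (inj₁ refl))

    has-nbr : ∀ {v} → v ∈ D → ∃ λ u → Adj G v u
    has-nbr {v} v∈D with connected v a
    ... | here         = ⊥-elim (a∉D v∈D)
    ... | step vu _    = _ , vu

    -- The certified dominating subset `D′` built from a hub `s`.

    module Hub (s : Fin n) (s∈D : s ∈ D) (sa : Adj G s a) where

      F? : Decidable (λ v → v ≡ s ⊎ IsSupport v)
      F? v = (v ≟ s) ⊎-dec any? λ l → Pendant? l v

      R? : Decidable (λ v → v ∈ D × ¬ IsLeaf v)
      R? v = (v ∈? D) ×-dec ¬? (any? (Pendant? v))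

      S : Subset n
      S = proj₁ (greedyIndependent F? R?)

      F⊆S : ∀ {v} → v ≡ s ⊎ IsSupport v → v ∈ S
      F⊆S = proj₁ (proj₂ (greedyIndependent F? R?))

      S⁻ : ∀ {v} → v ∈ S →
        (v ≡ s ⊎ IsSupport v) ⊎ ((v ∈ D × ¬ IsLeaf v) × (∀ {u} → u ∈ S → ¬ Adj G v u))
      S⁻ = proj₁ (proj₂ (proj₂ (greedyIndependent F? R?)))

      S-maximal : ∀ {v} → v ∈ D × ¬ IsLeaf v → v ∈ S ⊎ (∃ λ u → u ∈ S × Adj G v u)
      S-maximal = proj₂ (proj₂ (proj₂ (greedyIndependent F? R?)))

      S⊆D : ∀ {v} → v ∈ S → v ∈ D
      S⊆D v∈S with S⁻ v∈S
      ... | inj₁ (inj₁ refl)     = s∈D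
      ... | inj₁ (inj₂ (_ , lp)) = support∈D lp
      ... | inj₂ ((v∈D , _) , _) = v∈D

      leaf∉S : ∀ {l p} → Pendant l p → l ∉ S
      leaf∉S lp l∈S with S⁻ l∈S
      ... | inj₁ (inj₁ refl)      = leaf-¬a lp sa
      ... | inj₁ (inj₂ (_ , ql))  = support-¬leaf ql lp
      ... | inj₂ ((_ , ¬leaf) , _) = ¬leaf (_ , lp)

      OthersInS : Fin n → Fin n → Set
      OthersInS l p = ∀ u → Adj G p u → u ≢ l → u ∈ S

      abstract
        OthersInS? : ∀ l p → Dec (OthersInS l p)
        OthersInS? l p = all? λ u → T? (G p u) →-dec (¬? (u ≟ l) →-dec (u ∈? S))

      -- These are the leaves whose removal would leave the support with a single neighbour outside
      -- `D′`.
      KeptLeaf : Fin n → Set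
      KeptLeaf l = ∃ λ p → Pendant l p × OthersInS l p

      D′? : Decidable (λ v → v ∈ S ⊎ KeptLeaf v)
      D′? v = (v ∈? S) ⊎-dec any? λ p → Pendant? v p ×-dec OthersInS? v p

      D′ : Subset n
      D′ = comprehension D′?

      S⊆D′ : ∀ {v} → v ∈ S → v ∈ D′
      S⊆D′ = ∈-comprehension⁺ D′? ∘ inj₁

      D′⁻ : ∀ {v} → v ∈ D′ → v ∈ S ⊎ KeptLeaf v
      D′⁻ = ∈-comprehension⁻ D′?

      D′⊆D : D′ ⊆ D
      D′⊆D v∈ with D′⁻ v∈
      ... | inj₁ v∈S = S⊆D v∈S
      ... | inj₂ (_ , (v∈D , _) , _) = v∈D

      -- The hub dominates `a` and `b`, supports dominate their leaves, and maximality of the greedy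
      -- choice handles the other vertices.
      D′-dom : IsDominating G D′
      D′-dom v v∉ with v ∈? D
      ... | no v∉D with outside-D v v∉D
      ...   | inj₁ refl = s , S⊆D′ (F⊆S (inj₁ refl)) , Adj-sym sa
      ...   | inj₂ refl = s , S⊆D′ (F⊆S (inj₁ refl)) , Adj-sym (a-nbr⇒b-nbr s∈D sa)
      D′-dom v v∉ | yes v∈D with any? (Pendant? v)
      ...   | yes (p , vp@(_ , v-p , _)) = p , S⊆D′ (F⊆S (inj₂ (v , vp))) , v-p
      ...   | no ¬leaf with S-maximal (v∈D , ¬leaf)
      ...     | inj₁ v∈S = ⊥-elim (v∉ (S⊆D′ v∈S))
      ...     | inj₂ (u , u∈S , vu) = u , S⊆D′ u∈S , vu

      D′-zero-or-two : ∀ v → v ∈ D′ →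
        (∀ u → ¬ IsOutNbr D′ v u) ⊎ (∃₂ λ x y → x ≢ y × IsOutNbr D′ v x × IsOutNbr D′ v y)
      D′-zero-or-two v v∈ with T? (G v a)
      ... | yes va = inj₂ (a , b , a≢b , (va , a∉D ∘ D′⊆D) , (a-nbr⇒b-nbr (D′⊆D v∈) va , b∉D ∘ D′⊆D))
      ... | no ¬va with D′⁻ v∈
      -- The only neighbour of a kept leaf is its support, which belongs to `S`.
      ...   | inj₂ (p , vp@(_ , _ , only) , _) =
        inj₁ λ u (vu , u∉) → u∉ (S⊆D′ (F⊆S (inj₂ (v , subst (Pendant v) (sym (only u vu)) vp))))
      ...   | inj₁ v∈S with any? (λ l → Pendant? l v)
      ...     | yes (l , lv@(_ , l-v , l-only)) = support
        where
        support : (∀ u → ¬ IsOutNbr D′ v u) ⊎ (∃₂ λ x y → x ≢ y × IsOutNbr D′ v x × IsOutNbr D′ v y)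
        support with any? (λ u → T? (G v u) ×-dec ¬? (u ≟ l) ×-dec ¬? (u ∈? S))
        ... | no none = inj₁ zeroOut
          where
          others : OthersInS l v
          others u vu u≢l = decidable-stable (u ∈? S) λ u∉S → none (u , vu , u≢l , u∉S)
          zeroOut : ∀ u → ¬ IsOutNbr D′ v u
          zeroOut u (vu , u∉) with u ≟ l
          ... | yes refl = u∉ (∈-comprehension⁺ D′? (inj₂ (v , lv , others)))
          ... | no u≢l = u∉ (S⊆D′ (others u vu u≢l))
        ... | yes (u , vu , u≢l , u∉S) =
          inj₂ (u , l , u≢l , (vu , u∉D′) , (Adj-sym l-v , l∉D′))
          where
          -- As a kept leaf, `u` would hang from `v`, and its own condition would put `l` into `S`.
          u∉D′ : u ∉ D′
          u∉D′ u∈ with D′⁻ u∈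
          ... | inj₁ u∈S = u∉S u∈S
          ... | inj₂ (p , (_ , _ , only) , others) with only v (Adj-sym vu)
          ...   | refl = leaf∉S lv (others l (Adj-sym l-v) (u≢l ∘ sym))
          l∉D′ : l ∉ D′
          l∉D′ l∈ with D′⁻ l∈
          ... | inj₁ l∈S = leaf∉S lv l∈S
          ... | inj₂ (p , (_ , _ , only) , others) with only v l-v
          ...   | refl = u∉S (others u vu u≢l)
      ...     | no ¬support with S⁻ v∈S
      ...       | inj₁ (inj₁ refl) = ⊥-elim (¬va sa)
      ...       | inj₁ (inj₂ supp) = ⊥-elim (¬support supp)
      ...       | inj₂ ((v∈D , ¬leaf) , isolated) = inj₂ twoOut
        where
        -- A neighbour in `S` contradicts the greedy choice of `v`; a kept leaf next to `v` would
        -- make `v` a support.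
        nbr∉D′ : ∀ {u} → Adj G v u → u ∉ D′
        nbr∉D′ vu u∈ with D′⁻ u∈
        ... | inj₁ u∈S = isolated u∈S vu
        ... | inj₂ (p , up@(_ , _ , only) , _) with only v (Adj-sym vu)
        ...   | refl = ¬support (_ , up)
        twoOut : ∃₂ λ x y → x ≢ y × IsOutNbr D′ v x × IsOutNbr D′ v y
        twoOut with has-nbr v∈D
        ... | x , vx with any? (λ y → T? (G v y) ×-dec ¬? (y ≟ x))
        ...   | yes (y , vy , y≢x) = y , x , y≢x , (vy , nbr∉D′ vy) , (vx , nbr∉D′ vx)
        ...   | no unique = ⊥-elim (¬leaf (x , v∈D , vx , λ y vy →
          decidable-stable (y ≟ x) λ y≢x → unique (y , vy , y≢x)))

      -- Minimality of `D` applies; the remaining lemmas of this module read the structure of `D`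
      -- off `D′`.
      D⊆D′ : ∀ {v} → v ∈ D → v ∈ D′
      D⊆D′ = D-least D′ D′⊆D (D′-dom , zero-or-two⇒certified D′-zero-or-two)

      -- Every leaf lies in `D′` but not in `S`, so it is a kept leaf.
      leaf-others : ∀ {l p} → Pendant l p → OthersInS l p
      leaf-others lp@(l∈D , l-p , _) with D′⁻ (D⊆D′ l∈D)
      ... | inj₁ l∈S = ⊥-elim (leaf∉S lp l∈S)
      ... | inj₂ (q , (_ , _ , only) , others) with only _ l-p
      ...   | refl = others

      -- A second leaf at `p` would have to lie in `S`.
      leaf-unique : ∀ {l k p} → Pendant l p → Pendant k p → l ≡ k
      leaf-unique {l} {k} lp kp@(_ , k-p , _) = decidable-stable (l ≟ k) λ l≢k →
        leaf∉S kp (leaf-others lp k (Adj-sym k-p) (l≢k ∘ sym))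

      -- Apart from its leaf, a support has neighbours only in `S`, hence in `D`.
      support-¬a : ∀ {l p} → Pendant l p → ¬ Adj G p a
      support-¬a lp@(l∈D , _) pa = a∉D (S⊆D (leaf-others lp a pa (∈D⇒≢a l∈D ∘ sym)))

      trichotomy : ∀ {v} → v ∈ D → v ≢ s → IsLeaf v ⊎ IsSupport v ⊎ (∀ {u} → u ∈ D → ¬ Adj G v u)
      trichotomy {v} v∈D v≢s with D′⁻ (D⊆D′ v∈D)
      ... | inj₂ (p , vp , _) = inj₁ (p , vp)
      ... | inj₁ v∈S with any? (λ l → Pendant? l v)
      ...   | yes supp = inj₂ (inj₁ supp)
      ...   | no ¬supp with S⁻ v∈S
      ...     | inj₁ (inj₁ eq) = ⊥-elim (v≢s eq)
      ...     | inj₁ (inj₂ supp) = inj₂ (inj₁ supp)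
      ...     | inj₂ (_ , isolated) = inj₂ (inj₂ none)
        where
        none : ∀ {u} → u ∈ D → ¬ Adj G v u
        none u∈D vu with D′⁻ (D⊆D′ u∈D)
        ... | inj₁ u∈S = isolated u∈S vu
        ... | inj₂ (p , up@(_ , _ , only) , _) with only v (Adj-sym vu)
        ...   | refl = ¬supp (_ , up)

    -- Two hubs give a join, a single hub gives a crown.

    twoHubs⇒TwinHubs : ∀ {s t} → s ∈ D → Adj G s a → t ∈ D → Adj G t a → s ≢ t → TwinHubs (G a b)
    twoHubs⇒TwinHubs {s} {t} s∈D sa t∈D ta s≢t = record
      { a = a ; b = b ; a≢b = a≢b ; a-b = refl
      ; hub-a  = λ v≢a v≢b → proj₂ (hub v≢a v≢b)
      ; hub-b  = λ v≢a v≢b → let v∈D , va = hub v≢a v≢b in a-nbr⇒b-nbr v∈D va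
      ; others = λ u≢a u≢b v≢a v≢b →
          let u∈D , ua = hub u≢a u≢b in isolated u∈D ua (proj₁ (hub v≢a v≢b))
      }
      where
      -- The trichotomy is taken with base hub `r`, so that it applies to the hub `v`; as `v` sees
      -- `a`, it is neither a leaf nor a support.
      isolated-from : ∀ {v r} → v ∈ D → Adj G v a → r ∈ D → Adj G r a → v ≢ r → ∀ {u} → u ∈ D → ¬ Adj G v u
      isolated-from v∈D va r∈D ra v≢r with Hub.trichotomy _ r∈D ra v∈D v≢r
      ... | inj₁ (_ , vp)        = ⊥-elim (leaf-¬a vp va)
      ... | inj₂ (inj₁ (_ , lv)) = ⊥-elim (Hub.support-¬a _ r∈D ra lv va)
      ... | inj₂ (inj₂ none)     = none
      isolated : ∀ {v} → v ∈ D → Adj G v a → ∀ {u} → u ∈ D → ¬ Adj G v u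
      isolated {v} v∈D va with v ≟ s
      ... | yes refl = isolated-from v∈D va t∈D ta s≢t
      ... | no v≢s   = isolated-from v∈D va s∈D sa v≢s
      -- The pair and the hubs; this set is closed under adjacency, so connectedness makes it
      -- everything.
      Near : Fin n → Set
      Near v = (v ≡ a ⊎ v ≡ b) ⊎ (v ∈ D × Adj G v a)
      near-closed : ∀ {u w} → Near u → Adj G u w → Near w
      near-closed {u} {w} near uw with w ∈? D
      ... | no w∉D = inj₁ (outside-D w w∉D)
      ... | yes w∈D with near
      ...   | inj₁ (inj₁ refl) = inj₂ (w∈D , Adj-sym uw)
      ...   | inj₁ (inj₂ refl) = inj₂ (w∈D , b-nbr⇒a-nbr w∈D (Adj-sym uw))
      ...   | inj₂ (u∈D , ua) = ⊥-elim (isolated u∈D ua w∈D uw)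
      hub : ∀ {v} → v ≢ a → v ≢ b → v ∈ D × Adj G v a
      hub {v} v≢a v≢b with Reach-closed Near near-closed (connected a v) (inj₁ (inj₁ refl))
      ... | inj₁ eq = ⊥-elim ([ v≢a , v≢b ]′ eq)
      ... | inj₂ h = h

    oneHub⇒Crown : ∀ {s} → s ∈ D → Adj G s a → (∀ {t} → t ∈ D → Adj G t a → t ≡ s) → Crown (G a b)
    oneHub⇒Crown {s} s∈D sa unique = record
      { m = ∣ P ∣ ; supp = supp ; leaf = leaf ; top = b ; i₀ = i₀
      ; supp-inj  = enumerate-injective P
      ; leaf-inj  = λ {i} {j} eq → enumerate-injective P
          (leafOf-functional (leaf-of i) (subst (LeafOf (supp j)) (sym eq) (leaf-of j)))
      ; supp≢leaf = λ i j eq → supp-¬leaf (leaf-of i) (subst (LeafOf (supp j)) (sym eq) (leaf-of j))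
      ; top≢supp  = λ i eq → ∈D⇒≢b (supp∈D i) (sym eq)
      ; top≢leaf  = λ i eq → leafOf≢b (leaf-of i) (sym eq)
      ; cover     = cover
      ; leaf-leaf = λ i j → ¬T⇒≡false (leaves-nonadj (leaf-of i) (leaf-of j))
      ; supp-leaf = λ i j → ⌊⌋-unique (i ≟ j)
          (λ ij → enumerate-injective P (supp-leaf-adj⁻ (leaf-of i) (leaf-of j) ij))
          (λ { refl → leafOf-adj (leaf-of i) })
      ; top-supp  = λ i → ⌊⌋-unique (i ≟ i₀)
          (λ bi → enumerate-injective P (trans (hub-b (supp∈D i) (Adj-sym bi)) (sym supp-i₀)))
          (λ { refl → subst (Adj G b) (sym supp-i₀) (Adj-sym (a-nbr⇒b-nbr s∈D sa)) })
      ; top-leaf  = top-leaf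
      }
      where
      open Hub s s∈D sa using (leaf-unique; support-¬a; trichotomy)

      -- The support-leaf pairs of the corona that remains after `b` is removed: `a` serves as the
      -- leaf of `s`.
      LeafOf : Fin n → Fin n → Set
      LeafOf p l = (p ≡ s × l ≡ a) ⊎ Pendant l p

      P? : Decidable (λ p → ∃ λ l → LeafOf p l)
      P? p = any? λ l → ((p ≟ s) ×-dec (l ≟ a)) ⊎-dec Pendant? l p

      P : Subset n
      P = comprehension P?

      supp leaf : Fin ∣ P ∣ → Fin n
      supp = enumerate P
      leaf-of′ : ∀ i → ∃ λ l → LeafOf (supp i) l
      leaf-of′ i = ∈-comprehension⁻ P? (enumerate-∈ P i)
      leaf i = proj₁ (leaf-of′ i)

      leaf-of : ∀ i → LeafOf (supp i) (leaf i)
      leaf-of i = proj₂ (leaf-of′ i)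

      index : ∀ {p l} → LeafOf p l → ∃ λ i → supp i ≡ p
      index pl = enumerate-surjective P (∈-comprehension⁺ P? (_ , pl))

      i₀ : Fin ∣ P ∣
      i₀ = proj₁ (index (inj₁ (refl , refl)))

      supp-i₀ : supp i₀ ≡ s
      supp-i₀ = proj₂ (index (inj₁ (refl , refl)))

      hub-b : ∀ {v} → v ∈ D → Adj G v b → v ≡ s
      hub-b v∈D vb = unique v∈D (b-nbr⇒a-nbr v∈D vb)

      LeafOf⇒∈D : ∀ {p l} → LeafOf p l → p ∈ D
      LeafOf⇒∈D (inj₁ (refl , _)) = s∈D
      LeafOf⇒∈D (inj₂ lp) = support∈D lp

      supp∈D : ∀ i → supp i ∈ D
      supp∈D i = LeafOf⇒∈D (leaf-of i)

      leafOf-adj : ∀ {p l} → LeafOf p l → Adj G p l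
      leafOf-adj (inj₁ (refl , refl)) = sa
      leafOf-adj (inj₂ (_ , l-p , _)) = Adj-sym l-p

      leafOf≢b : ∀ {p l} → LeafOf p l → l ≢ b
      leafOf≢b (inj₁ (_ , refl)) eq = a≢b eq
      leafOf≢b (inj₂ (l∈D , _)) = ∈D⇒≢b l∈D

      supp-leaf-adj⁻ : ∀ {p l q k} → LeafOf p l → LeafOf q k → Adj G p k → p ≡ q
      supp-leaf-adj⁻ pl (inj₁ (refl , refl)) pk = unique (LeafOf⇒∈D pl) pk
      supp-leaf-adj⁻ pl (inj₂ (_ , _ , only)) pk = only _ (Adj-sym pk)

      leafOf-functional : ∀ {p q l} → LeafOf p l → LeafOf q l → p ≡ q
      leafOf-functional pl ql = supp-leaf-adj⁻ pl ql (leafOf-adj pl)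

      -- The hub carries no leaf besides `a`, because supports of leaves in `D` miss `a`.
      leafOf-unique : ∀ {p l k} → LeafOf p l → LeafOf p k → l ≡ k
      leafOf-unique (inj₁ (_ , refl)) (inj₁ (_ , refl)) = refl
      leafOf-unique (inj₁ (refl , refl)) (inj₂ kp) = ⊥-elim (support-¬a kp sa)
      leafOf-unique (inj₂ lp) (inj₁ (refl , refl)) = ⊥-elim (support-¬a lp sa)
      leafOf-unique (inj₂ lp) (inj₂ kp) = leaf-unique lp kp

      supp-¬leaf : ∀ {p l q} → LeafOf p l → ¬ LeafOf q p
      supp-¬leaf pl (inj₁ (_ , refl)) = a∉D (LeafOf⇒∈D pl)
      supp-¬leaf (inj₁ (refl , _)) (inj₂ sq) = leaf-¬a sq sa
      supp-¬leaf (inj₂ lp) (inj₂ pq) = support-¬leaf lp pq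

      leaves-nonadj : ∀ {p l q k} → LeafOf p l → LeafOf q k → ¬ Adj G l k
      leaves-nonadj (inj₁ (_ , refl)) (inj₁ (_ , refl)) = Adj-irrefl
      leaves-nonadj (inj₁ (_ , refl)) (inj₂ kq) ak = leaf-¬a kq (Adj-sym ak)
      leaves-nonadj (inj₂ lp) (inj₁ (_ , refl)) la = leaf-¬a lp la
      leaves-nonadj (inj₂ lp@(_ , _ , only)) (inj₂ kq) lk with only _ lk
      ... | refl = support-¬leaf lp kq

      leafOf⇒leaf : ∀ {p l} → LeafOf p l → ∃ λ i → leaf i ≡ l
      leafOf⇒leaf pl with index pl
      ... | i , refl = i , leafOf-unique (leaf-of i) pl

      cover : ∀ v → v ≡ b ⊎ (∃ λ i → supp i ≡ v) ⊎ (∃ λ i → leaf i ≡ v)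
      cover v with v ∈? D
      ... | no v∉D with outside-D v v∉D
      ...   | inj₁ refl = inj₂ (inj₂ (leafOf⇒leaf (inj₁ (refl , refl))))
      ...   | inj₂ eq = inj₁ eq
      cover v | yes v∈D with v ≟ s
      ...   | yes refl = inj₂ (inj₁ (i₀ , supp-i₀))
      ...   | no v≢s with trichotomy v∈D v≢s
      ...     | inj₁ (p , vp) = inj₂ (inj₂ (leafOf⇒leaf (inj₂ vp)))
      ...     | inj₂ (inj₁ (l , lv)) = inj₂ (inj₁ (index (inj₂ lv)))
      ...     | inj₂ (inj₂ none) with has-nbr v∈D
      -- As `v` is not the hub, its neighbour `u` lies in `D`, which the third alternative forbids.
      ...       | u , vu = ⊥-elim (none (nbr∈D v∈D (v≢s ∘ unique v∈D) vu) vu)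

      leaf-i₀ : leaf i₀ ≡ a
      leaf-i₀ = leafOf-unique (leaf-of i₀) (inj₁ (supp-i₀ , refl))

      -- At `i₀` the leaf is `a`, which gives the flag `G a b`; every other leaf misses `a` and
      -- hence `b`.
      top-leaf : ∀ i → G b (leaf i) ≡ G a b ∧ ⌊ i ≟ i₀ ⌋
      top-leaf i with i ≟ i₀
      ... | yes refl = trans (cong (G b) leaf-i₀) (trans (proj₁ simple b a) (sym (∧-identityʳ (G a b))))
      ... | no i≢i₀ with leaf-of i
      ...   | inj₁ (i≡s , _) = ⊥-elim (i≢i₀ (enumerate-injective P (trans i≡s (sym supp-i₀))))
      ...   | inj₂ ip@(l∈D , _) = trans
        (¬T⇒≡false λ bl → leaf-¬a ip (b-nbr⇒a-nbr l∈D (Adj-sym bl))) (sym (∧-zeroʳ (G a b)))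

    TwinHubs-or-Crown : TwinHubs (G a b) ⊎ Crown (G a b)
    TwinHubs-or-Crown with D-dom a a∉D
    -- The vertex dominating `a` is a hub; the case depends on whether `D` has another one.
    ... | s , s∈D , as with any? (λ t → (t ∈? D) ×-dec T? (G t a) ×-dec ¬? (t ≟ s))
    ...   | yes (t , t∈D , ta , t≢s) = inj₁ (twoHubs⇒TwinHubs t∈D ta s∈D (Adj-sym as) t≢s)
    ...   | no none = inj₂ (oneHub⇒Crown s∈D (Adj-sym as) λ {t} t∈D ta →
      decidable-stable (t ≟ s) λ t≢s → none (t , t∈D , ta , t≢s))

theorem3p3 : (n : ℕ) (G : Graph n) → IsSimple G → Connected G → 3 ≤ n →
    (GammaCerIs G (n ∸ 2) ⇔
    (IsSimpleDiadem G ⊎ IsDiadem G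
    ⊎ Iso (join (complete 2) (edgeless (n ∸ 2))) G
    ⊎ Iso (join (edgeless 2) (edgeless (n ∸ 2))) G))
theorem3p3 n G simple connected 3≤n = mk⇔ only-if if
  where
  open SimpleGraph G simple

  Conclusion : Set
  Conclusion = IsSimpleDiadem G ⊎ IsDiadem G
    ⊎ Iso (join (complete 2) (edgeless (n ∸ 2))) G ⊎ Iso (join (edgeless 2) (edgeless (n ∸ 2))) G

  TwinHubs⇒Conclusion : ∀ c → TwinHubs c → Conclusion
  TwinHubs⇒Conclusion true  = inj₂ ∘ inj₂ ∘ inj₁ ∘ TwinHubs⇒Iso
  TwinHubs⇒Conclusion false = inj₂ ∘ inj₂ ∘ inj₂ ∘ TwinHubs⇒Iso

  Crown⇒Conclusion : ∀ c → Crown c → Conclusion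
  Crown⇒Conclusion c crown with Crown⇒Iso crown
  Crown⇒Conclusion false crown | H , H-simple , iso =
    inj₁ (m , H , H-simple , i₀ , iso (simpleDiadem-topNbrs i₀))
    where open Crown crown
  Crown⇒Conclusion true crown | H , H-simple , iso =
    inj₂ (inj₁ (m , H , H-simple , i₀ , iso (diadem-topNbrs i₀)))
    where open Crown crown

  only-if : GammaCerIs G (n ∸ 2) → Conclusion
  only-if ((D , ((dom , cert) , D-min) , ∣D∣≡n∸2) , _)
    with ∣S∣≡n∸2⇒pair D (≤-trans (s≤s (s≤s z≤n)) 3≤n) ∣D∣≡n∸2
  ... | a , b , a≢b , a∉D , b∉D , outside-D =
    -- The edge between `a` and `b` decides between the two joins, and between a diadem and a simple
    -- diadem.
    [ TwinHubs⇒Conclusion (G a b) , Crown⇒Conclusion (G a b) ]′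
      (MissingPair.TwinHubs-or-Crown connected D dom cert D-min a b a≢b a∉D b∉D outside-D)

  if : Conclusion → GammaCerIs G (n ∸ 2)
  if (inj₁ (m , H , _ , s , iso)) = Crown⇒Γ≡n∸2 (Iso⇒Crown (simpleDiadem-topNbrs s) iso)
  if (inj₂ (inj₁ (m , H , _ , s , iso))) = Crown⇒Γ≡n∸2 (Iso⇒Crown (diadem-topNbrs s) iso)
  if (inj₂ (inj₂ (inj₁ iso))) = TwinHubs⇒Γ≡n∸2 3≤n (Iso⇒TwinHubs {true} iso)
  if (inj₂ (inj₂ (inj₂ iso))) = TwinHubs⇒Γ≡n∸2 3≤n (Iso⇒TwinHubs {false} iso)
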